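{- For every positive integer $n$ we have $f_A(n)\ge 2n-9$.
   Context: A tree $T$ is hidden on a known vertex set $V$ with $|V|=n$. A distance query is an unordered pair $\{x,y\}$ of distinct vertices of $V$, and its answer is the distance $d_T(x,y)$ of $x$ and $y$ in $T$. In an adaptive algorithm each query may depend on the answers to the previous queries. A tree on $V$ is consistent with the answers received so far if its distance between every queried pair equals the answer. $f_A(n)$ is the smallest integer $k$ such that there is an adaptive algorithm which, for every hidden tree $T$ on $V$, after at most $k$ queries reaches a state in which there exist two vertices $x,y$ such that, in every tree consistent with the answers, the distance of $x$ and $y$ equals the maximum distance (diameter) of that tree. -}

module Defs where

open import Data.Nat using (ℕ; zero; suc; _≤_)
open import Data.Fin using (Fin)
open import Data.Bool using (Bool; true; false)
open import Data.List using (List; []; _∷_; _++_; length)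
open import Data.List.Relation.Unary.All using (All)
open import Data.List.Relation.Unary.Unique.Propositional using (Unique)
open import Data.Product using (Σ; ∃; ∃₂; _×_; _,_)
open import Relation.Binary.PropositionalEquality using (_≡_)
open import Relation.Nullary using (¬_)
open import Data.Empty using (⊥)

Graph : ℕ → Set
Graph n = Fin n → Fin n → Bool

module _ {n : ℕ} (G : Graph n) where

  Adj : Fin n → Fin n → Set
  Adj x y = G x y ≡ true

  data Walk : Fin n → Fin n → ℕ → Set where
    stay : ∀ {x} → Walk x x 0
    edge : ∀ {x y z k} → Adj x y → Walk y z k → Walk x z (suc k)

  data Linked : List (Fin n) → Set where
    one  : ∀ {x} → Linked (x ∷ [])
    cons : ∀ {x y vs} → Adj x y → Linked (y ∷ vs) → Linked (x ∷ y ∷ vs)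

  HasCycle : Set
  HasCycle = ∃₂ λ (x : Fin n) (ws : List (Fin n)) →
               (2 ≤ length ws) × Unique (x ∷ ws) × Linked (x ∷ ws ++ x ∷ [])

  Symmetric : Set
  Symmetric = ∀ x y → G x y ≡ G y x

  Irreflexive : Set
  Irreflexive = ∀ x → G x x ≡ false

  Connected : Set
  Connected = ∀ x y → ∃ λ k → Walk x y k

  IsTree : Set
  IsTree = Symmetric × Irreflexive × Connected × (¬ HasCycle)

  Dist : Fin n → Fin n → ℕ → Set
  Dist x y d = Walk x y d × (∀ m → Walk x y m → d ≤ m)

  DiamPair : Fin n → Fin n → Set
  DiamPair x y = ∀ u v a b → Dist x y a → Dist u v b → b ≤ a

-- Knowledge: list of answered queries (x , y , d) meaning d(x,y) = d
Knowledge : ℕ → Set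
Knowledge n = List (Fin n × Fin n × ℕ)

Consistent : ∀ {n} → Graph n → Knowledge n → Set
Consistent T K = All (λ { (x , y , d) → Dist T x y d }) K

Solved : ∀ {n} → Knowledge n → Set
Solved {n} K = ∃₂ λ (x y : Fin n) →
  ∀ (T : Graph n) → IsTree T → Consistent T K → DiamPair T x y

data Alg (n : ℕ) : Set where
  stop : Alg n
  ask  : (x y : Fin n) → ¬ (x ≡ y) → (ℕ → Alg n) → Alg n

-- Good T K A k : running algorithm state A against hidden tree T, starting with
-- knowledge K, a solved state is reached after at most k further queries.
data Good {n : ℕ} (T : Graph n) : Knowledge n → Alg n → ℕ → Set where
  done : ∀ {K A k} → Solved K → Good T K A k
  step : ∀ {K x y p f k d} → Dist T x y d →
         Good T ((x , y , d) ∷ K) (f d) k → Good T K (ask x y p f) (suc k)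

{-# OPTIONS --safe #-}
-- The adversary answers as if the hidden tree were a double star with centres a and b (and one more
-- reserved vertex w), each other vertex being a leaf at a (label true) or at b (label false). The
-- labels are decided lazily: a query joining two components of the graph of queries is answered as if
-- the labels differ. In the double star a diametral pair has opposite labels, hence odd distance at
-- most 3. So the algorithm has to exclude every consistent tree of diameter 4 in which some of the
-- leaves at b hang from a leaf w₁ of a instead, and likewise with a and b exchanged; for this the
-- queries within each label class must connect that class, up to the constraints that come from
-- queries at w₁ and w₂. As long as three components remain, such a tree exists. When two remain, after
-- n - 4 joining queries, take for w₁ and w₂ a vertex with at most one joining query in each component,
-- and fix all labels so that these two differ. None of the joining queries helps to connect the
-- classes, which takes n - 2 further edges, of which at most three are already accounted for:
-- (n - 4) + (n - 2) - 3 = 2n - 9.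
module Submission where

open import Defs
open import Data.Nat using (ℕ; zero; suc; _≤_; _<_; _+_; _*_; _∸_; z≤n; s≤s; _≤?_)
open import Data.Nat.Properties using (≤-refl; ≤-trans; ≤-antisym; m≤m+n; n≤1+n; +-suc; +-comm; m≤n⇒m<n∨m≡n; m∸n≤m; <⇒≱;
  ≰⇒>; ≤-reflexive; +-assoc; +-identityʳ; +-monoˡ-≤; +-monoʳ-≤; *-monoʳ-≤; +-cancelʳ-≤; m∸n+n≡m; module ≤-Reasoning)
open import Data.Nat.Solver using (module +-*-Solver)
open import Data.Bool using (Bool; true; false; not; _∧_; _∨_; _xor_; if_then_else_)
open import Data.Bool.Properties using (∨-comm; ∧-zeroʳ; ∨-zeroʳ; xor-comm; not-involutive; not-injective) renaming (_≟_ to _≟ᵇ_)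
open import Data.Fin using (Fin; zero; suc)
open import Data.Fin.Properties using (_≟_; injective⇒≤; ¬∀⟶∃¬)
open import Data.List using (List; []; _∷_; _++_; length; map; lookup)
open import Data.List.Properties using (length-++; length-map)
open import Data.List.Membership.Propositional using (_∈_)
open import Data.List.Membership.Propositional.Properties using (∈-++⁺ˡ; ∈-++⁺ʳ; ∈-map⁺)
open import Data.List.Relation.Unary.All using (All; []; _∷_)
open import Data.List.Relation.Unary.AllPairs using (_∷_)
open import Data.List.Relation.Unary.Any using (here; there)
open import Data.List.Relation.Unary.Any.Properties using (lookup-index)
import Data.List.Relation.Unary.All as All
import Data.List.Relation.Unary.Any as Any
open import Data.Product using (∃; _×_; _,_; proj₁; proj₂)
open import Data.Sum using (_⊎_; inj₁; inj₂; [_,_]′)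
open import Data.Empty using (⊥; ⊥-elim)
open import Relation.Nullary using (¬_; Dec; yes; no; does)
open import Relation.Nullary.Decidable using (dec-true; dec-false)
open import Relation.Binary.PropositionalEquality using (_≡_; _≢_; refl; sym; trans; cong; cong₂; subst; ≢-sym)
open +-*-Solver using (solve; con; _:+_; _:=_)

-- Walks and distances

module _ {n : ℕ} {G : Graph n} where

  walk-trans : ∀ {x y z k l} → Walk G x y k → Walk G y z l → Walk G x z (k + l)
  walk-trans stay       q = q
  walk-trans (edge e p) q = edge e (walk-trans p q)

  walk-sym : Symmetric G → ∀ {x y k} → Walk G x y k → Walk G y x k
  walk-sym s stay = stay
  walk-sym s {y = z} (edge {x} {y} {k = k} e p) =
    subst (Walk G z x) (+-comm k 1) (walk-trans (walk-sym s p) (edge (trans (s y x) e) stay))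

  dist-sym : Symmetric G → ∀ {x y d} → Dist G x y d → Dist G y x d
  dist-sym s (p , m) = walk-sym s p , λ l q → m l (walk-sym s q)

  dist-unique : ∀ {x y d e} → Dist G x y d → Dist G x y e → d ≡ e
  dist-unique (p , m) (q , l) = ≤-antisym (m _ q) (l _ p)

-- Rooted trees of depth at most two

module ParentTree {n : ℕ} (r : Fin n) (par : Fin n → Fin n) (par-par : ∀ v → par (par v) ≡ r) where

  -- The equation `par (par v) ≡ r` bounds the depth by 2 and makes `r` its own parent; the first
  -- factor removes the resulting loop.
  graph : Graph n
  graph x y = not (does (x ≟ y)) ∧ (does (par x ≟ y) ∨ does (par y ≟ x))

  par-r : par r ≡ r
  par-r = trans (cong par (sym (par-par r))) (par-par (par r))

  par-fixed : ∀ {v} → par v ≡ v → v ≡ r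
  par-fixed {v} e = trans (sym (trans (cong par e) e)) (par-par v)

  -- Each of the two vertices is its own grandparent, that is, the root.
  par-swap : ∀ {x y} → par x ≡ y → par y ≡ x → x ≡ y
  par-swap {x} {y} e f = trans (trans (sym f) (trans (cong par (sym e)) (par-par x)))
                               (trans (sym (par-par y)) (trans (cong par f) e))

  adj⁻ : ∀ {x y} → Adj graph x y → x ≢ y × (par x ≡ y ⊎ par y ≡ x)
  adj⁻ {x} {y} e with x ≟ y | par x ≟ y | par y ≟ x
  ... | no d  | yes p | _     = d , inj₁ p
  ... | no d  | no _  | yes p = d , inj₂ p

  adj-up : ∀ {x y} → x ≢ y → par x ≡ y → Adj graph x y
  adj-up {x} {y} d p rewrite dec-false (x ≟ y) d | dec-true (par x ≟ y) p = refl

  symmetric : Symmetric graph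
  symmetric x y with x ≟ y | y ≟ x
  ... | yes _ | yes _ = refl
  ... | yes p | no q  = ⊥-elim (q (sym p))
  ... | no p  | yes q = ⊥-elim (p (sym q))
  ... | no _  | no _  = ∨-comm (does (par x ≟ y)) _

  adj-down : ∀ {x y} → x ≢ y → par y ≡ x → Adj graph x y
  adj-down {x} {y} d p = trans (symmetric x y) (adj-up (≢-sym d) p)

  irreflexive : Irreflexive graph
  irreflexive x rewrite dec-true (x ≟ x) refl = refl

  par≢self : ∀ {v} → v ≢ r → par v ≢ v
  par≢self p e = p (par-fixed e)

  sibling-walk : ∀ {x y p} → par x ≡ p → par y ≡ p → x ≢ r → y ≢ r → Walk graph x y 2
  sibling-walk {x} {y} {p} f g d e =
    edge {y = p} (adj-up {x} {p} (λ { refl → par≢self d f }) f)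
    (edge (adj-down {p} {y} (λ { refl → par≢self e g }) g) stay)

  walk-root : ∀ v → ∃ λ k → Walk graph v r k
  walk-root v with v ≟ r | par v ≟ r
  ... | yes refl | _     = 0 , stay
  ... | no d     | yes p = 1 , edge (adj-up d p) stay
  ... | no d     | no q  = 2 , edge (adj-up (λ e → d (par-fixed (sym e))) refl) (edge (adj-up q (par-par v)) stay)

  connected : Connected graph
  connected x y = _ , walk-trans (proj₂ (walk-root x)) (walk-sym symmetric (proj₂ (walk-root y)))

  -- For `c ≢ r` this is the whole subtree at `c`, because the depth is at most 2.
  Below : Fin n → Fin n → Set
  Below c u = u ≡ c ⊎ par u ≡ c

  below-up : ∀ {c u v} → par u ≡ v → u ≢ c → Below c u → Below c v
  below-up refl d (inj₁ e) = ⊥-elim (d e)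
  below-up refl d (inj₂ e) = inj₁ e

  below-down : ∀ {c u v} → c ≢ r → par u ≡ v → Below c v → Below c u
  below-down d refl (inj₁ e) = inj₂ e
  below-down {u = u} d refl (inj₂ e) = ⊥-elim (d (trans (sym e) (par-par u)))

  Crossing : Fin n → Fin n → Fin n → Set
  Crossing c u v = (u ≡ c × v ≡ par c) ⊎ (v ≡ c × u ≡ par c)

  below-edge : ∀ {c u v} → c ≢ r → Adj graph u v → ¬ Crossing c u v →
               (Below c u → Below c v) × (Below c v → Below c u)
  below-edge d e nc with adj⁻ e
  ... | _ , inj₁ refl = below-up refl (λ { refl → nc (inj₁ (refl , refl)) }) , below-down d refl
  ... | _ , inj₂ refl = below-down d refl , below-up refl (λ { refl → nc (inj₂ (refl , refl)) })

  -- The subtree at `c` is attached only by the edge from `c` to its parent, and a path that avoids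
  -- one end `y` of this edge cannot use it.
  below-path : ∀ {c y} → c ≢ r → c ≡ y ⊎ par c ≡ y → ∀ v vs z → Linked graph (v ∷ vs ++ z ∷ []) →
               All (y ≢_) (v ∷ vs) → y ≢ z → (Below c v → Below c z) × (Below c z → Below c v)
  below-path {c} {y} cr cy = go
    where
    on-crossing : ∀ {u v} → Crossing c u v → c ≡ y ⊎ par c ≡ y → u ≡ y ⊎ v ≡ y
    on-crossing (inj₁ (refl , refl)) e        = e
    on-crossing (inj₂ (refl , refl)) (inj₁ e) = inj₂ e
    on-crossing (inj₂ (refl , refl)) (inj₂ e) = inj₁ e
    nocross : ∀ {u v} → y ≢ u → y ≢ v → ¬ Crossing c u v
    nocross p q k = [ (λ e → p (sym e)) , (λ e → q (sym e)) ]′ (on-crossing k cy)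
    go : ∀ v vs z → Linked graph (v ∷ vs ++ z ∷ []) → All (y ≢_) (v ∷ vs) → y ≢ z →
         (Below c v → Below c z) × (Below c z → Below c v)
    go v [] z (cons e _) (p ∷ []) q = below-edge cr e (nocross p q)
    go v (u ∷ vs) z (cons e l) (p ∷ p′ ∷ ps) q =
      let f , g = below-edge cr e (nocross p p′)
          h , k = go u vs z l (p′ ∷ ps) q
      in (λ b → h (f b)) , (λ b → g (k b))

  -- Removing the first edge of a cycle leaves a path joining its ends, but the end that is the
  -- child c of the other is separated from it by the set of vertices below c.
  acyclic : ¬ HasCycle graph
  acyclic (x , [] , () , _)
  acyclic (x , _ ∷ [] , s≤s () , _)
  acyclic (x , y ∷ y′ ∷ ws , _ , ((x≢y ∷ x≢y′ ∷ _) ∷ (y≢y′ ∷ y≢ws) ∷ _) , cons e (cons e′ l)) with adj⁻ e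
  ... | _ , inj₁ p = ends (proj₂ first (proj₂ (below-path cr (inj₂ p) y′ ws x l (y≢y′ ∷ y≢ws) (≢-sym x≢y)) (inj₁ refl)))
    where
    cr : x ≢ r
    cr refl = x≢y (trans (sym par-r) p)
    first = below-edge cr e′ λ { (inj₁ (q , _)) → x≢y (sym q) ; (inj₂ (q , _)) → x≢y′ (sym q) }
    ends : Below x y → ⊥
    ends (inj₁ q) = x≢y (sym q)
    ends (inj₂ q) = x≢y (par-swap p q)
  ... | _ , inj₂ p = ends (proj₁ (below-path cr (inj₁ refl) y′ ws x l (y≢y′ ∷ y≢ws) (≢-sym x≢y)) (proj₁ first (inj₁ refl)))
    where
    cr : y ≢ r
    cr refl = x≢y (trans (sym p) par-r)
    first = below-edge cr e′ λ { (inj₁ (_ , q)) → x≢y′ (sym (trans q p)) ; (inj₂ (q , _)) → y≢y′ (sym q) }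
    ends : Below y x → ⊥
    ends (inj₁ q) = x≢y q
    ends (inj₂ q) = x≢y (par-swap q p)

  isTree : IsTree graph
  isTree = symmetric , irreflexive , connected , acyclic

  -- Distances through common ancestors

  anc : ℕ → Fin n → Fin n
  anc zero    v = v
  anc (suc i) v = anc i (par v)

  par-anc : ∀ i v → par (anc i v) ≡ anc (suc i) v
  par-anc zero    v = refl
  par-anc (suc i) v = par-anc i (par v)

  -- Induction on the walk: a first edge going up lengthens the climb from `x`; one going down
  -- cancels a step of that climb or, if there is none, lengthens the climb from `z`. Lower bounds
  -- on distances thus reduce to inequations between ancestors.
  walk-anc : ∀ {x z m} → Walk graph x z m → ∃ λ i → ∃ λ j → anc i x ≡ anc j z × i + j ≤ m
  walk-anc stay = 0 , 0 , refl , z≤n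
  walk-anc (edge e p) with walk-anc p | adj⁻ e
  ... | i , j , q , l     | _ , inj₁ refl = suc i , j , q , s≤s l
  ... | suc i , j , q , l | _ , inj₂ refl = i , j , q , ≤-trans (≤-trans (n≤1+n _) l) (n≤1+n _)
  ... | zero , j , q , l  | _ , inj₂ refl = 0 , suc j , trans (cong par q) (par-anc j _) , s≤s l

  Apart : ℕ → Fin n → Fin n → Set
  Apart d x z = ∀ i j → anc i x ≡ anc j z → d ≤ i + j

  dist : ∀ {d x z} → Walk graph x z d → Apart d x z → Dist graph x z d
  dist p ap = p , λ m q → let i , j , e , l = walk-anc q in ≤-trans (ap i j e) l

  apart₀ : ∀ {x z} → Apart 0 x z
  apart₀ _ _ _ = z≤n

  -- Only the pairs with `i + j ≡ d` are new. In `apart₃` and `apart₄`, `par-par` identifies every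
  -- ancestor from the second on with the root.
  apart-suc : ∀ {d x z} → Apart d x z → (∀ i j → i + j ≡ d → anc i x ≢ anc j z) → Apart (suc d) x z
  apart-suc ap h i j e with m≤n⇒m<n∨m≡n (ap i j e)
  ... | inj₁ l = l
  ... | inj₂ q = ⊥-elim (h i j (sym q) e)

  apart₁ : ∀ {x z} → x ≢ z → Apart 1 x z
  apart₁ d = apart-suc apart₀ λ { zero zero refl → d }

  apart₂ : ∀ {x z} → x ≢ z → par x ≢ z → x ≢ par z → Apart 2 x z
  apart₂ d p q = apart-suc (apart₁ d) λ { zero _ refl → q ; (suc zero) _ refl → p }

  apart₃ : ∀ {x z} → Apart 2 x z → par x ≢ par z → x ≢ r → z ≢ r → Apart 3 x z
  apart₃ {x} {z} ap p q t = apart-suc ap λ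
    { zero             _ refl e → q (trans e (par-par z))
    ; (suc zero)       _ refl   → p
    ; (suc (suc zero)) _ refl e → t (trans (sym e) (par-par x)) }

  apart₄ : ∀ {x z} → Apart 3 x z → x ≢ r → z ≢ r → par x ≢ r → par z ≢ r → Apart 4 x z
  apart₄ {x} {z} ap q t q′ t′ = apart-suc ap λ
    { zero                   _ refl e → q (trans e (par-par (par z)))
    ; (suc zero)             _ refl e → q′ (trans e (par-par z))
    ; (suc (suc zero))       _ refl e → t′ (trans (sym e) (par-par x))
    ; (suc (suc (suc zero))) _ refl e → t (trans (sym e) (par-par (par x))) }

-- Double stars and their shifted variants

-- Distances in a double star: leaves with equal labels share a centre, and sp is 1 at the two
-- centres and 0 elsewhere.
answer : ∀ {n} → (Fin n → ℕ) → (Fin n → Bool) → Fin n → Fin n → ℕ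
answer sp L x y = (if L x xor L y then 3 else 2) ∸ (sp x + sp y)

module _ {n : ℕ} (sp : Fin n → ℕ) where

  answer-cong : ∀ {L L′ x y} → L x xor L y ≡ L′ x xor L′ y → answer sp L x y ≡ answer sp L′ x y
  answer-cong {x = x} {y} e = cong (λ c → (if c then 3 else 2) ∸ (sp x + sp y)) e

  answer-sym : ∀ L x y → answer sp L x y ≡ answer sp L y x
  answer-sym L x y = cong₂ (λ c k → (if c then 3 else 2) ∸ k) (xor-comm (L x) (L y)) (+-comm (sp x) (sp y))

  answer-value : ∀ {L x y p q i j} → L x ≡ p → L y ≡ q → sp x ≡ i → sp y ≡ j →
                 answer sp L x y ≡ (if p xor q then 3 else 2) ∸ (i + j)
  answer-value refl refl refl refl = refl

  answer-same : ∀ L x y → L x ≡ L y → answer sp L x y ≤ 2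
  answer-same L x y e with L x | L y | e
  ... | true  | _ | refl = m∸n≤m 2 (sp x + sp y)
  ... | false | _ | refl = m∸n≤m 2 (sp x + sp y)

  answer-≤3 : ∀ L x y → answer sp L x y ≤ 3
  answer-≤3 L x y with L x xor L y
  ... | true  = m∸n≤m 3 (sp x + sp y)
  ... | false = ≤-trans (m∸n≤m 2 (sp x + sp y)) (n≤1+n 2)

true⊎false : ∀ b → b ≡ true ⊎ b ≡ false
true⊎false true  = inj₁ refl
true⊎false false = inj₂ refl

true≢false : ∀ {b : Bool} → b ≡ true → b ≢ false
true≢false refl ()

differ : ∀ {n} {L : Fin n → Bool} {x y} → L x ≡ true → L y ≡ false → x ≢ y
differ p q refl = true≢false p q

-- The centres are parameters, and `sp` enters only through its values, so that the module also
-- applies with the centres exchanged and the labels negated.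
module Bistar {n : ℕ} (a b : Fin n) (sp : Fin n → ℕ) (sp-a : sp a ≡ 1) (sp-b : sp b ≡ 1)
              (sp-rest : ∀ v → v ≢ a → v ≢ b → sp v ≡ 0)
              (L : Fin n → Bool) (La : L a ≡ true) (Lb : L b ≡ false)
              (w : Fin n) (w≢a : w ≢ a) (Lw : L w ≡ true) where

  -- For empty S this is the double star with centres a and b, whose distances are the values of
  -- `answer`; moving S from b to w gives diameter 4.
  module Shifted (S : Fin n → Bool) (S⊆ : ∀ u → S u ≡ true → L u ≡ false × u ≢ b) where

    par : Fin n → Fin n
    -- As `L a` is true, the root `a` is its own parent.
    par v = if does (v ≟ b) ∨ L v then a else (if S v then w else b)

    par-true : ∀ {v} → L v ≡ true → par v ≡ a
    par-true {v} p rewrite p | ∨-zeroʳ (does (v ≟ b)) = refl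

    par-b : par b ≡ a
    par-b rewrite dec-true (b ≟ b) refl = refl

    par-out : ∀ {v} → L v ≡ false → v ≢ b → S v ≡ false → par v ≡ b
    par-out {v} p q s rewrite dec-false (v ≟ b) q | p | s = refl

    par-in : ∀ {v} → S v ≡ true → par v ≡ w
    par-in {v} s rewrite dec-false (v ≟ b) (proj₂ (S⊆ v s)) | proj₁ (S⊆ v s) | s = refl

    data Kind (v : Fin n) : Set where
      root  : v ≡ a → Kind v
      hub   : v ≡ b → Kind v
      upper : v ≢ a → L v ≡ true → Kind v
      lower : v ≢ b → L v ≡ false → Kind v

    kind : ∀ v → Kind v
    kind v with v ≟ a | v ≟ b | L v in e
    ... | yes p | _     | _     = root p
    ... | no _  | yes q | _     = hub q
    ... | no p  | no _  | true  = upper p e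
    ... | no _  | no q  | false = lower q e

    par-lower : ∀ {v} → v ≢ b → L v ≡ false → (S v ≡ true × par v ≡ w) ⊎ (S v ≡ false × par v ≡ b)
    par-lower {v} q p with true⊎false (S v)
    ... | inj₁ s = inj₁ (s , par-in s)
    ... | inj₂ s = inj₂ (s , par-out p q s)

    par-par : ∀ v → par (par v) ≡ a
    par-par v with kind v
    ... | root refl = trans (cong par (par-true La)) (par-true La)
    ... | hub refl  = trans (cong par par-b) (par-true La)
    ... | upper _ p = trans (cong par (par-true p)) (par-true La)
    ... | lower q p with par-lower q p
    ... | inj₁ (_ , e) = trans (cong par e) (par-true Lw)
    ... | inj₂ (_ , e) = trans (cong par e) par-b

    open ParentTree a par par-par public

    a≢b : a ≢ b
    a≢b = differ {L = L} La Lb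

    w≢b : w ≢ b
    w≢b = differ {L = L} Lw Lb

    lower≢a : ∀ {v} → L v ≡ false → v ≢ a
    lower≢a p refl = true≢false La p

    upper≢b : ∀ {v} → L v ≡ true → v ≢ b
    upper≢b p refl = true≢false p Lb

    par-lower≢a : ∀ {v} → v ≢ b → L v ≡ false → par v ≢ a
    par-lower≢a q p e with par-lower q p
    ... | inj₁ (_ , f) = w≢a (trans (sym f) e)
    ... | inj₂ (_ , f) = a≢b (trans (sym e) f)

    -- The move changes the distances from `S` to `w` and to the other vertices labelled false, `b`
    -- included, and no others; the conditions exclude just these pairs.
    Unaffected : Fin n → Fin n → Set
    Unaffected x y = (L x ≡ L y → S x ≡ S y) × (x ≡ w → S y ≡ false) × (y ≡ w → S x ≡ false)

    S-b : S b ≡ false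
    S-b with S b in s
    ... | true  = ⊥-elim (proj₂ (S⊆ b s) refl)
    ... | false = refl

    private
      A : Fin n → Fin n → ℕ
      A = answer sp L

      to : ∀ {x y d} → A x y ≡ d → Dist graph x y d → Dist graph x y (A x y)
      to e p = subst (Dist graph _ _) (sym e) p

      flip : ∀ {x y} → Dist graph y x (A y x) → Dist graph x y (A x y)
      flip {x} {y} p = subst (Dist graph x y) (answer-sym sp L y x) (dist-sym symmetric p)

      sp-upper : ∀ {v} → v ≢ a → L v ≡ true → sp v ≡ 0
      sp-upper d p = sp-rest _ d (upper≢b p)

      sp-lower : ∀ {v} → v ≢ b → L v ≡ false → sp v ≡ 0
      sp-lower d p = sp-rest _ (lower≢a p) d

      root-hub : Dist graph a b (A a b)
      root-hub = to (answer-value sp {L} La Lb sp-a sp-b)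
                    (dist (edge (adj-down a≢b par-b) stay) (apart₁ a≢b))

      root-upper : ∀ {y} → y ≢ a → L y ≡ true → Dist graph a y (A a y)
      root-upper d p = to (answer-value sp {L} La p sp-a (sp-upper d p))
                          (dist (edge (adj-down (≢-sym d) (par-true p)) stay) (apart₁ (≢-sym d)))

      root-lower : ∀ {y} → y ≢ b → L y ≡ false → Dist graph a y (A a y)
      root-lower {y} d p = to (answer-value sp {L} La p sp-a (sp-lower d p))
        (dist (edge (adj-down (≢-sym q) (par-par y)) (edge (adj-down (par≢self (lower≢a p)) refl) stay))
              (apart₂ (≢-sym (lower≢a p)) (λ e → lower≢a p (trans (sym e) par-r)) (≢-sym q)))
        where q = par-lower≢a d p

      hub-upper : ∀ {y} → y ≢ a → L y ≡ true → Dist graph b y (A b y)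
      hub-upper d p = to (answer-value sp {L} Lb p sp-b (sp-upper d p))
        (dist (sibling-walk par-b (par-true p) (≢-sym a≢b) d)
              (apart₂ (≢-sym (upper≢b p)) (λ e → d (trans (sym e) par-b))
                      (λ e → a≢b (trans (sym (par-true p)) (sym e)))))

      hub-lower : ∀ {y} → y ≢ b → L y ≡ false → Unaffected b y → Dist graph b y (A b y)
      hub-lower d p (s , _) = to (answer-value sp {L} Lb p sp-b (sp-lower d p))
        (dist (edge (adj-down (≢-sym d) (par-out p d (trans (sym (s (trans Lb (sym p)))) S-b))) stay) (apart₁ (≢-sym d)))

      upper-upper : ∀ {x y} → x ≢ y → x ≢ a → L x ≡ true → y ≢ a → L y ≡ true → Dist graph x y (A x y)
      upper-upper x≢y d p e q = to (answer-value sp {L} p q (sp-upper d p) (sp-upper e q))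
        (dist (sibling-walk (par-true p) (par-true q) d e)
              (apart₂ x≢y (λ f → e (trans (sym f) (par-true p))) (λ f → d (trans f (par-true q)))))

    upper-lower-apart : ∀ {x y} → x ≢ a → L x ≡ true → y ≢ b → L y ≡ false → par y ≢ x → Apart 3 x y
    upper-lower-apart d p e q f =
      apart₃ (apart₂ (differ {L = L} p q) (λ g → lower≢a q (trans (sym g) (par-true p))) (≢-sym f))
             (λ g → par-lower≢a e q (trans (sym g) (par-true p))) d (lower≢a q)

    private
      upper-lower : ∀ {x y} → x ≢ a → L x ≡ true → y ≢ b → L y ≡ false → Unaffected x y → Dist graph x y (A x y)
      upper-lower {x} {y} d p e q (_ , s , _) = to (answer-value sp {L} p q (sp-upper d p) (sp-lower e q))
        (dist (edge (adj-up d (par-true p)) (edge (adj-down (≢-sym (par-lower≢a e q)) (par-par y))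
                (edge (adj-down (par≢self (lower≢a q)) refl) stay)))
              (upper-lower-apart d p e q far))
        where
        far : par y ≢ x
        far f with par-lower e q
        ... | inj₁ (t , g) = true≢false t (s (trans (sym f) g))
        ... | inj₂ (_ , g) = upper≢b p (trans (sym f) g)

      par-same : ∀ {x y} → x ≢ b → L x ≡ false → y ≢ b → L y ≡ false → S x ≡ S y → par x ≡ par y
      par-same d p e q s with par-lower d p | par-lower e q
      ... | inj₁ (_ , f) | inj₁ (_ , g) = trans f (sym g)
      ... | inj₂ (_ , f) | inj₂ (_ , g) = trans f (sym g)
      ... | inj₁ (t , _) | inj₂ (u , _) = ⊥-elim (true≢false t (trans s u))
      ... | inj₂ (t , _) | inj₁ (u , _) = ⊥-elim (true≢false u (trans (sym s) t))

    lower-lower-apart : ∀ {x y} → x ≢ y → x ≢ b → L x ≡ false → y ≢ b → L y ≡ false → Apart 2 x y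
    lower-lower-apart x≢y d p e q = apart₂ x≢y (far d p e q) (λ f → far e q d p (sym f))
      where
      far : ∀ {u v} → u ≢ b → L u ≡ false → v ≢ b → L v ≡ false → par u ≢ v
      far d p e q f with par-lower d p
      ... | inj₁ (_ , g) = true≢false Lw (trans (cong L (trans (sym g) f)) q)
      ... | inj₂ (_ , g) = e (trans (sym f) g)

    private
      lower-lower : ∀ {x y} → x ≢ y → x ≢ b → L x ≡ false → y ≢ b → L y ≡ false → Unaffected x y →
                    Dist graph x y (A x y)
      lower-lower x≢y d p e q (s , _) = to (answer-value sp {L} p q (sp-lower d p) (sp-lower e q))
        (dist (sibling-walk (par-same d p e q (s (trans p (sym q)))) refl (lower≢a p) (lower≢a q))
              (lower-lower-apart x≢y d p e q))

    unaffected-sym : ∀ {x y} → Unaffected x y → Unaffected y x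
    unaffected-sym (s , p , q) = (λ e → sym (s (sym e))) , q , p

    dist-answer : ∀ {x y} → x ≢ y → Unaffected x y → Dist graph x y (answer sp L x y)
    dist-answer {x} {y} d u with kind x | kind y
    ... | root refl | root refl = ⊥-elim (d refl)
    ... | root refl | hub refl  = root-hub
    ... | root refl | upper q p = root-upper q p
    ... | root refl | lower q p = root-lower q p
    ... | hub refl  | root refl = flip root-hub
    ... | hub refl  | hub refl  = ⊥-elim (d refl)
    ... | hub refl  | upper q p = hub-upper q p
    ... | hub refl  | lower q p = hub-lower q p u
    ... | upper q p | root refl = flip (root-upper q p)
    ... | upper q p | hub refl  = flip (hub-upper q p)
    ... | upper q p | upper s t = upper-upper d q p s t
    ... | upper q p | lower s t = upper-lower q p s t u
    ... | lower q p | root refl = flip (root-lower q p)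
    ... | lower q p | hub refl  = flip (hub-lower q p (unaffected-sym u))
    ... | lower q p | upper s t = flip (upper-lower s t q p (unaffected-sym u))
    ... | lower q p | lower s t = lower-lower d q p s t u

    -- Among pairs with opposite labels only those of `w` with `S` change, and their distance drops
    -- to 1.
    dist-opposite-≤3 : ∀ {x y} → L x ≡ true → L y ≡ false → ∃ λ d → d ≤ 3 × Dist graph x y d
    dist-opposite-≤3 {x} {y} p q with x ≟ w | true⊎false (S y)
    ... | yes refl | inj₁ s = 1 , s≤s z≤n , dist (edge (adj-down x≢y (par-in s)) stay) (apart₁ x≢y)
      where x≢y = differ {L = L} p q
    ... | yes refl | inj₂ s = answer sp L x y , answer-≤3 sp L x y , dist-answer (differ {L = L} p q)
            ((λ e → ⊥-elim (true≢false (trans (sym e) p) q)) , (λ _ → s) , (λ { refl → ⊥-elim (true≢false Lw q) }))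
    ... | no x≢w   | _      = answer sp L x y , answer-≤3 sp L x y , dist-answer (differ {L = L} p q)
            ((λ e → ⊥-elim (true≢false (trans (sym e) p) q)) , (λ e → ⊥-elim (x≢w e)) , (λ { refl → ⊥-elim (true≢false Lw q) }))

    -- Both ends have depth 2 and hang from the different vertices `w` and `b`, so the path runs
    -- through the root.
    dist-shifted : ∀ {s z} → S s ≡ true → z ≢ b → L z ≡ false → S z ≡ false → Dist graph s z 4
    dist-shifted {s} {z} Ss z≢b Lz Sz = dist
        (edge (adj-up (≢-sym (par≢self s≢a)) refl) (edge (adj-up ps (par-par s))
          (edge (adj-down (≢-sym pz) (par-par z)) (edge (adj-down (par≢self z≢a) refl) stay))))
        (apart₄ (apart₃ (lower-lower-apart (λ { refl → true≢false Ss Sz }) s≢b Ls z≢b Lz)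
                        (λ e → w≢b (trans (sym (par-in Ss)) (trans e (par-out Lz z≢b Sz)))) s≢a z≢a)
                s≢a z≢a ps pz)
      where
      Ls = proj₁ (S⊆ s Ss)
      s≢b = proj₂ (S⊆ s Ss)
      s≢a = lower≢a Ls
      z≢a = lower≢a Lz
      ps = par-lower≢a s≢b Ls
      pz = par-lower≢a z≢b Lz

  module Star = Shifted (λ _ → false) (λ _ ())

  Answered : Fin n × Fin n × ℕ → Set
  Answered (x , y , d) = x ≢ y × d ≡ answer sp L x y

  star-unaffected : ∀ {x y} → Star.Unaffected x y
  star-unaffected = (λ _ → refl) , (λ _ → refl) , (λ _ → refl)

  star-consistent : ∀ {K} → All Answered K → Consistent Star.graph K
  star-consistent = All.map λ { {x , y , d} (p , refl) → Star.dist-answer p star-unaffected }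

  -- The double star forces a diametral pair to have opposite labels, the shifted tree forbids it.
  unsolved : (S : Fin n → Bool) (S⊆ : ∀ u → S u ≡ true → L u ≡ false × u ≢ b) →
             ∀ {K} → All Answered K →
             All (λ (x , y , d) → Shifted.Unaffected S S⊆ x y) K →
             ∀ s z → S s ≡ true → z ≢ b → L z ≡ false → S z ≡ false → ¬ Solved K
  unsolved S S⊆ {K} ans un s z Ss z≢b Lz Sz (x , y , sol) = contra (L x ≟ᵇ L y)
    where
    module T = Shifted S S⊆
    consistent : Consistent T.graph K
    consistent = All.zipWith (λ { {x , y , d} ((p , refl) , u) → T.dist-answer p u }) (ans , un)
    opposite : ∀ {x y} → DiamPair T.graph x y → L x ≡ true → L y ≡ false → ⊥
    opposite {x} {y} diam p q with T.dist-opposite-≤3 p q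
    ... | d , l , xy with ≤-trans (diam s z _ _ xy (T.dist-shifted Ss z≢b Lz Sz)) l
    ... | s≤s (s≤s (s≤s ()))
    diamT : DiamPair T.graph x y
    diamT = sol T.graph T.isTree consistent
    wz : Dist Star.graph w z 3
    wz = subst (Dist Star.graph w z)
               (answer-value sp {L} Lw Lz (sp-rest w w≢a (Star.upper≢b Lw)) (sp-rest z (Star.lower≢a Lz) z≢b))
               (Star.dist-answer (differ {L = L} Lw Lz) star-unaffected)
    close : L x ≡ L y → ∃ λ d → d ≤ 2 × Dist Star.graph x y d
    close e with x ≟ y
    ... | yes refl = 0 , z≤n , stay , λ _ _ → z≤n
    ... | no x≢y   = _ , answer-same sp L x y e , Star.dist-answer x≢y star-unaffected
    contra : Dec (L x ≡ L y) → ⊥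
    contra (yes e) with close e
    ... | d , l , xy with ≤-trans (sol Star.graph Star.isTree (star-consistent ans) w z _ _ xy wz) l
    ... | s≤s (s≤s ())
    contra (no e) with true⊎false (L x) | true⊎false (L y)
    ... | inj₁ p | inj₁ q = e (trans p (sym q))
    ... | inj₂ p | inj₂ q = e (trans p (sym q))
    ... | inj₁ p | inj₂ q = opposite diamT p q
    ... | inj₂ p | inj₁ q = opposite (λ u v k l f g → diamT u v k l (dist-sym T.symmetric f) g) q p

  -- Take for `S` the vertices labelled false with the colour of `v`. A query with equal labels has
  -- both ends in `S` or both outside, and the conditions on `w` keep its queried partners out of
  -- `S`, so no answer tells the shifted tree from the double star.
  unsolved-class : (c : Fin n → Fin n) (v z : Fin n) → L v ≡ false → c v ≢ c b →
                   z ≢ b → L z ≡ false → c z ≢ c v → ∀ {K} → All Answered K →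
                   All (λ (x , y , d) → (L x ≡ L y → c x ≡ c y)
                                      × (x ≡ w → L y ≡ false → c y ≢ c v)
                                      × (y ≡ w → L x ≡ false → c x ≢ c v)) K →
                   ¬ Solved K
  unsolved-class c v z Lv v≁b z≢b Lz z≁v ans resp =
    unsolved S S⊆ ans (All.map (λ { {x , y , d} (p , q , r) →
      (λ e → cong₂ (λ i j → does (i ≟ c v) ∧ not j) (p e) e) , moved q , moved r }) resp)
      v z S-self z≢b Lz (S-out z≁v)
    where
    S : Fin n → Bool
    S u = does (c u ≟ c v) ∧ not (L u)
    S-out : ∀ {u} → c u ≢ c v → S u ≡ false
    S-out {u} d rewrite dec-false (c u ≟ c v) d = refl
    S-self : S v ≡ true
    S-self rewrite dec-true (c v ≟ c v) refl | Lv = refl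
    S⊆ : ∀ u → S u ≡ true → L u ≡ false × u ≢ b
    S⊆ u e with c u ≟ c v | L u
    ... | yes p | false = refl , λ { refl → v≁b (sym p) }
    moved : ∀ {x y} → (x ≡ w → L y ≡ false → c y ≢ c v) → x ≡ w → S y ≡ false
    moved {x} {y} h e with true⊎false (L y)
    ... | inj₁ p = trans (cong (λ j → does (c y ≟ c v) ∧ not j) p) (∧-zeroʳ _)
    ... | inj₂ p = S-out (h e p)

-- Components of edge lists

Edges : ℕ → Set
Edges n = List (Fin n × Fin n)

module _ {n : ℕ} where

  -- Quick-find: each edge recolours the class of its first end like its second, so connectedness
  -- becomes a decidable equality of colours.
  colour : Edges n → Fin n → Fin n
  colour []            v = v
  colour ((x , y) ∷ E) v = if does (colour E v ≟ colour E x) then colour E y else colour E v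

  colour-mono : ∀ E e {u v} → colour E u ≡ colour E v → colour (e ∷ E) u ≡ colour (e ∷ E) v
  colour-mono E (x , y) p = cong (λ c → if does (c ≟ colour E x) then colour E y else c) p

  colour-here : ∀ E x y → colour ((x , y) ∷ E) x ≡ colour ((x , y) ∷ E) y
  colour-here E x y rewrite dec-true (colour E x ≟ colour E x) refl with does (colour E y ≟ colour E x)
  ... | true  = refl
  ... | false = refl

  colour-edge : ∀ E {x y} → (x , y) ∈ E → colour E x ≡ colour E y
  colour-edge (e ∷ E) (here refl) = colour-here E _ _
  colour-edge (e ∷ E) (there m)   = colour-mono E e (colour-edge E m)

  colour-other : ∀ E x y {v} → colour E v ≢ colour E x → colour ((x , y) ∷ E) v ≡ colour E v
  colour-other E x y {v} d rewrite dec-false (colour E v ≟ colour E x) d = refl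

  -- Pigeonhole: otherwise the index in `ps` would be an injection from `Fin n` into a smaller set.
  not-listed : (ps : List (Fin n)) → length ps < n → ∃ λ v → ¬ v ∈ ps
  not-listed ps l = ¬∀⟶∃¬ n (_∈ ps) (λ v → Any.any? (v ≟_) ps) λ all →
    <⇒≱ l (injective⇒≤ {f = λ v → Any.index (all v)} λ {u} {v} e →
      trans (lookup-index (all u)) (trans (cong (lookup ps) e) (sym (lookup-index (all v)))))

  -- An edge destroys at most one colour. The induction trades the edge `(x , y)` for one more
  -- vertex to avoid: `x` if no listed vertex has its old colour, otherwise `y`, whose colour those
  -- listed vertices receive.
  new-colour : ∀ E ps → length E + length ps < n → ∃ λ v → All (λ p → colour E v ≢ colour E p) ps
  new-colour [] ps l = let v , h = not-listed ps l in v , All.tabulate λ { m refl → h m }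
  new-colour ((x , y) ∷ E) ps l with Any.any? (λ p → colour E p ≟ colour E x) ps
  ... | no none with new-colour E (x ∷ ps) (subst (_< n) (sym (+-suc (length E) (length ps))) l)
  ... | v , v≁x ∷ h = v , All.tabulate λ {p} m e →
          All.lookup h m (trans (sym (colour-other E x y v≁x))
                         (trans e (colour-other E x y (λ q → none (Any.map (λ { refl → q }) m)))))
  new-colour ((x , y) ∷ E) ps l | yes some
    with new-colour E (y ∷ ps) (subst (_< n) (sym (+-suc (length E) (length ps))) l)
  ... | v , v≁y ∷ h = v , All.tabulate λ {p} m e → split p m (trans (sym (colour-other E x y v≁x)) e)
    where
    v≁x : colour E v ≢ colour E x
    v≁x e = let d , q = All.lookupAny h some in d (trans e (sym q))
    split : ∀ p → p ∈ ps → colour E v ≢ colour ((x , y) ∷ E) p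
    split p m e with does (colour E p ≟ colour E x)
    ... | true  = v≁y e
    ... | false = All.lookup h m e

  -- Flip the whole class of `v` if `L v` differs from `t`. Answers depend on labels only through
  -- their xor, so those inside a class survive.
  relabel : (c : Fin n → Fin n) (L : Fin n → Bool) (v : Fin n) (t : Bool) → ∃ λ L′ →
            L′ v ≡ t × (∀ z → c z ≢ c v → L′ z ≡ L z) ×
            (∀ u z → c u ≡ c z → L u xor L z ≡ L′ u xor L′ z)
  relabel c L v t = L′ , at-v , away , xors
    where
    L′ : Fin n → Bool
    L′ z = if does (c z ≟ c v) then L z xor (L v xor t) else L z
    cancel : ∀ p q → p xor (p xor q) ≡ q
    cancel true  q = not-involutive q
    cancel false q = refl
    at-v : L′ v ≡ t
    at-v rewrite dec-true (c v ≟ c v) refl = cancel (L v) t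
    away : ∀ z → c z ≢ c v → L′ z ≡ L z
    away z d rewrite dec-false (c z ≟ c v) d = refl
    shift : ∀ p q k → p xor q ≡ (p xor k) xor (q xor k)
    shift true  true  true  = refl
    shift true  true  false = refl
    shift true  false true  = refl
    shift true  false false = refl
    shift false true  true  = refl
    shift false true  false = refl
    shift false false true  = refl
    shift false false false = refl
    xors : ∀ u z → c u ≡ c z → L u xor L z ≡ L′ u xor L′ z
    xors u z e rewrite e with does (c z ≟ c v)
    ... | true  = shift (L u) (L z) (L v xor t)
    ... | false = refl

xor-true : ∀ {p q} → p xor q ≡ true → p ≢ q
xor-true {true}  {true}  () refl
xor-true {false} {false} () refl

xor-not : ∀ p → p xor not p ≡ true
xor-not true  = refl
xor-not false = refl

not-xor-not : ∀ p q → p xor q ≡ not p xor not q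
not-xor-not true  q = refl
not-xor-not false q = sym (not-involutive q)

not-false : ∀ {p} → not p ≡ false → p ≡ true
not-false {true} _ = refl

-- The adversary and its reserved vertices

module Adversary {n : ℕ} (a b w : Fin n) (a≢b : a ≢ b) (w≢a : w ≢ a) (w≢b : w ≢ b) (5≤n : 5 ≤ n) where

  sp : Fin n → ℕ
  sp v = if does (v ≟ a) ∨ does (v ≟ b) then 1 else 0

  sp-a : sp a ≡ 1
  sp-a rewrite dec-true (a ≟ a) refl = refl

  sp-b : sp b ≡ 1
  sp-b rewrite dec-true (b ≟ b) refl | ∨-zeroʳ (does (b ≟ a)) = refl

  sp-rest : ∀ v → v ≢ a → v ≢ b → sp v ≡ 0
  sp-rest v p q rewrite dec-false (v ≟ a) p | dec-false (v ≟ b) q = refl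

  Answered : (Fin n → Bool) → Fin n × Fin n × ℕ → Set
  Answered L (x , y , d) = x ≢ y × d ≡ answer sp L x y

  answered-cong : ∀ {L L′} e → L (proj₁ e) xor L (proj₁ (proj₂ e)) ≡ L′ (proj₁ e) xor L′ (proj₁ (proj₂ e)) →
                  Answered L e → Answered L′ e
  answered-cong {L} {L′} (x , y , d) e (p , q) = p , trans q (answer-cong sp {L} {L′} e)

  answered-not : ∀ L {K} → All (Answered L) K → All (Answered (λ v → not (L v))) K
  answered-not L = All.map λ { {x , y , d} → answered-cong {L} {λ v → not (L v)} (x , y , d) (not-xor-not (L x) (L y)) }

  -- The labels of these three vertices are fixed from the start, so they count as one component. As
  -- each edge put into `M` joins two components, `n - 2 - length M` of them remain.
  base : Edges n
  base = (a , b) ∷ (a , w) ∷ []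

  component : Edges n → Fin n → Fin n
  component M = colour (M ++ base)

  component-base : ∀ M {x y} → (x , y) ∈ base → component M x ≡ component M y
  component-base M m = colour-edge (M ++ base) (∈-++⁺ʳ M m)

  -- Tips of the forest of joining queries

  Regular : Fin n → Set
  Regular t = t ≢ a × t ≢ b

  Nbr : Edges n → Fin n → Fin n → Set
  Nbr M t u = (t , u) ∈ M ⊎ (u , t) ∈ M

  -- The witness is arbitrary if `t` has no neighbour.
  AtMostOneNbr : Edges n → Fin n → Set
  AtMostOneNbr M t = ∃ λ z → ∀ u → Nbr M t u → u ≡ z

  Isolated : Edges n → Fin n → Set
  Isolated M t = Regular t × (∀ u → ¬ Nbr M t u)

  Tip : Edges n → Fin n → Set
  Tip M t = t ≡ a ⊎ (Regular t × AtMostOneNbr M t)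

  -- The second alternative is for one-vertex components, whose only tip may be `x` itself.
  TipAvoiding : Edges n → Fin n → Fin n → Set
  TipAvoiding M x v = ∃ λ t → component M t ≡ component M v × Tip M t × (t ≢ x ⊎ Isolated M t)

  -- A component is a single vertex or has two tips; a plays the role of a tip because the initial
  -- component {a, b, w} is treated as one contracted vertex of the forest M.
  Tips : Edges n → Set
  Tips M = ∀ v x → TipAvoiding M x v

  core : ∀ v {x} → component [] a ≡ component [] v → TipAvoiding [] x v
  core v {x} e = by-cases (x ≟ a)
    where
    by-cases : Dec (x ≡ a) → TipAvoiding [] x v
    by-cases (yes refl) = w , trans (sym (component-base [] (there (here refl)))) e ,
                          inj₂ ((w≢a , w≢b) , w , λ { _ (inj₁ ()) ; _ (inj₂ ()) }) , inj₁ w≢a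
    by-cases (no d)     = a , e , inj₁ refl , inj₁ (≢-sym d)

  tips-[] : Tips []
  tips-[] v x = by-cases (v ≟ a) (v ≟ b) (v ≟ w)
    where
    by-cases : Dec (v ≡ a) → Dec (v ≡ b) → Dec (v ≡ w) → TipAvoiding [] x v
    by-cases (no p) (no q) (no _) = v , refl , inj₂ ((p , q) , v , λ { _ (inj₁ ()) ; _ (inj₂ ()) }) ,
                                    inj₂ ((p , q) , λ { _ (inj₁ ()) ; _ (inj₂ ()) })
    by-cases (yes refl) _ _ = core v refl
    by-cases (no _) (yes refl) _ = core v (component-base [] (here refl))
    by-cases (no _) (no _) (yes refl) = core v (component-base [] (there (here refl)))

  nbr-tail : ∀ {M x y t u} → t ≢ x → t ≢ y → Nbr ((x , y) ∷ M) t u → Nbr M t u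
  nbr-tail p q (inj₁ (here refl)) = ⊥-elim (p refl)
  nbr-tail p q (inj₁ (there m))   = inj₁ m
  nbr-tail p q (inj₂ (here refl)) = ⊥-elim (q refl)
  nbr-tail p q (inj₂ (there m))   = inj₂ m

  nbr-sym : ∀ {M x y t u} → Nbr ((x , y) ∷ M) t u → Nbr ((y , x) ∷ M) t u
  nbr-sym (inj₁ (here refl)) = inj₂ (here refl)
  nbr-sym (inj₁ (there m))   = inj₁ (there m)
  nbr-sym (inj₂ (here refl)) = inj₁ (here refl)
  nbr-sym (inj₂ (there m))   = inj₂ (there m)

  tip-far : ∀ {M x y t} → t ≢ x → t ≢ y → Tip M t → Tip ((x , y) ∷ M) t
  tip-far p q (inj₁ e) = inj₁ e
  tip-far p q (inj₂ (r , z , h)) = inj₂ (r , z , λ u m → h u (nbr-tail p q m))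

  -- An isolated `x` gets `y` as its only neighbour and remains a tip; any other tip of its
  -- component is untouched by the new edge.
  tip-end : ∀ {M x y t} → t ≢ y → Tip M t → t ≢ x ⊎ Isolated M t → Tip ((x , y) ∷ M) t
  tip-end q τ (inj₁ p) = tip-far p q τ
  tip-end {M} {x} {y} q τ (inj₂ (r , iso)) = inj₂ (r , y , nbr)
    where
    nbr : ∀ u → Nbr ((x , y) ∷ M) _ u → u ≡ y
    nbr u (inj₁ (here refl)) = refl
    nbr u (inj₁ (there m))   = ⊥-elim (iso u (inj₁ m))
    nbr u (inj₂ (here refl)) = ⊥-elim (q refl)
    nbr u (inj₂ (there m))   = ⊥-elim (iso u (inj₂ m))

  tip-sym : ∀ {M x y t} → Tip ((x , y) ∷ M) t → Tip ((y , x) ∷ M) t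
  tip-sym (inj₁ e) = inj₁ e
  tip-sym (inj₂ (r , z , h)) = inj₂ (r , z , λ u m → h u (nbr-sym m))

  apart : ∀ M {t v u} → component M t ≡ component M v → component M v ≢ component M u → t ≢ u
  apart M e d refl = d (sym e)

  -- Each side has a tip that survives the new edge at its end. The two come from different
  -- components, so one of them is not `q`.
  tip-merged : ∀ {M x y} → component M x ≢ component M y → Tips M →
               ∀ q → TipAvoiding ((x , y) ∷ M) q x
  tip-merged {M} {x} {y} x≁y τ q with τ x x | τ y y
  ... | t , t∼x , tip , alt | s , s∼y , tip′ , alt′ with t ≟ q
  ... | no t≢q   = t , colour-mono (M ++ base) (x , y) t∼x , tip-end (apart M t∼x x≁y) tip alt , inj₁ t≢q
  ... | yes refl = s , trans (colour-mono (M ++ base) (x , y) s∼y) (sym (colour-here (M ++ base) x y)) ,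
                   tip-sym (tip-end (apart M s∼y (≢-sym x≁y)) tip′ alt′) ,
                   inj₁ (λ { refl → x≁y (trans (sym t∼x) s∼y) })

  tips-∷ : ∀ {M x y} → component M x ≢ component M y → Tips M → Tips ((x , y) ∷ M)
  tips-∷ {M} {x} {y} x≁y τ v q = by-cases (component M v ≟ component M x) (component M v ≟ component M y)
    where
    by-cases : Dec (component M v ≡ component M x) → Dec (component M v ≡ component M y) →
               TipAvoiding ((x , y) ∷ M) q v
    by-cases (no v≁x) (no v≁y) =
      let t , e , tip , alt = τ v q
          t≢x = apart M e v≁x
          t≢y = apart M e v≁y
      in t , colour-mono (M ++ base) (x , y) e , tip-far t≢x t≢y tip ,
         [ inj₁ , (λ (r , iso) → inj₂ (r , λ u m → iso u (nbr-tail t≢x t≢y m))) ]′ alt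
    by-cases (yes v∼x) _ =
      let t , e , h = tip-merged x≁y τ q
      in t , trans e (sym (colour-mono (M ++ base) (x , y) v∼x)) , h
    by-cases (no _) (yes v∼y) =
      let t , e , h = tip-merged x≁y τ q
      in t , trans e (trans (colour-here (M ++ base) x y) (sym (colour-mono (M ++ base) (x , y) v∼y))) , h

  -- The growing phase

  -- M holds the queries that joined two components, all answered as if the labels differed, and N
  -- the other queries. Labels are only determined up to a flip of each component not containing a.
  record Forest (K : Knowledge n) (L : Fin n → Bool) (M : Edges n) : Set where
    field
      N        : Edges n
      La       : L a ≡ true
      Lb       : L b ≡ false
      Lw       : L w ≡ true
      M-differ : ∀ {x y} → (x , y) ∈ M → L x xor L y ≡ true
      answered : All (Answered L) K
      joined   : All (λ (x , y , d) → component M x ≡ component M y) K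
      covered  : All (λ (x , y , d) → (x , y) ∈ M ⊎ (x , y) ∈ N) K
      tips     : Tips M
      count    : length M + length N ≤ length K

  open Forest

  forest-relabel : ∀ {K L M} → Forest K L M → ∀ v → component M v ≢ component M a → ∀ t → ∃ λ L′ →
                   Forest K L′ M × L′ v ≡ t × (∀ z → component M z ≢ component M v → L′ z ≡ L z)
  forest-relabel {K} {L} {M} F v v≁a t with relabel (component M) L v t
  ... | L′ , at-v , away , xors = L′ , record
    { N        = N F
    ; La       = trans (away a (≢-sym v≁a)) (La F)
    ; Lb       = trans (away b (λ e → v≁a (trans (sym e) (sym (component-base M (here refl)))))) (Lb F)
    ; Lw       = trans (away w (λ e → v≁a (trans (sym e) (sym (component-base M (there (here refl))))))) (Lw F)
    ; M-differ = λ m → trans (sym (xors _ _ (colour-edge (M ++ base) (∈-++⁺ˡ m)))) (M-differ F m)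
    ; answered = All.zipWith (λ { {x , y , d} (e , p) → answered-cong {L} {L′} (x , y , d) (xors x y e) p })
                             (joined F , answered F)
    ; joined   = joined F
    ; covered  = covered F
    ; tips     = tips F
    ; count    = count F
    } , at-v , away

  forest-join : ∀ {K L M x y} → Forest K L M → x ≢ y → component M x ≡ component M y →
                Forest ((x , y , answer sp L x y) ∷ K) L M
  forest-join {K} {M = M} {x} {y} F x≢y x∼y = record
    { N        = (x , y) ∷ N F
    ; La       = La F
    ; Lb       = Lb F
    ; Lw       = Lw F
    ; M-differ = M-differ F
    ; answered = (x≢y , refl) ∷ answered F
    ; joined   = x∼y ∷ joined F
    ; covered  = inj₂ (here refl) ∷ All.map (λ { (inj₁ m) → inj₁ m ; (inj₂ m) → inj₂ (there m) }) (covered F)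
    ; tips     = tips F
    ; count    = subst (_≤ suc (length K)) (sym (+-suc (length M) (length (N F)))) (s≤s (count F))
    }

  forest-merge : ∀ {K L M x y} → Forest K L M → x ≢ y → component M x ≢ component M y → L x xor L y ≡ true →
                 Forest ((x , y , answer sp L x y) ∷ K) L ((x , y) ∷ M)
  forest-merge {M = M} {x} {y} F x≢y x≁y diff = record
    { N        = N F
    ; La       = La F
    ; Lb       = Lb F
    ; Lw       = Lw F
    ; M-differ = λ { (here refl) → diff ; (there m) → M-differ F m }
    ; answered = (x≢y , refl) ∷ answered F
    ; joined   = colour-here (M ++ base) x y ∷ All.map (colour-mono (M ++ base) (x , y)) (joined F)
    ; covered  = inj₁ (here refl) ∷ All.map (λ { (inj₁ m) → inj₁ (there m) ; (inj₂ m) → inj₂ m }) (covered F)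
    ; tips     = tips-∷ x≁y (tips F)
    ; count    = s≤s (count F)
    }

  -- At most one of the two components contains `a`; the other may be flipped until the labels of
  -- `x` and `y` differ.
  forest-separate : ∀ {K L M x y} → Forest K L M → x ≢ y → component M x ≢ component M y →
                    ∃ λ L′ → Forest ((x , y , answer sp L′ x y) ∷ K) L′ ((x , y) ∷ M)
  forest-separate {L = L} {M} {x} {y} F x≢y x≁y with component M x ≟ component M a
  ... | yes x∼a with forest-relabel F y (λ y∼a → x≁y (trans x∼a (sym y∼a))) (not (L x))
  ... | L′ , F′ , p , away = L′ , forest-merge F′ x≢y x≁y
          (trans (cong₂ _xor_ (away x x≁y) p) (xor-not (L x)))
  forest-separate {L = L} {M} {x} {y} F x≢y x≁y | no x≁a with forest-relabel F x x≁a (not (L y))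
  ... | L′ , F′ , p , away = L′ , forest-merge F′ x≢y x≁y
          (trans (cong₂ _xor_ p (away y (≢-sym x≁y))) (trans (xor-comm (not (L y)) (L y)) (xor-not (L y))))

  -- Choose `v` and `u` in two further components, with `v` relabelled as a leaf at `a` and `u` as a
  -- leaf at `b`. Hang the true-labelled part of the component of `v` from `u`: all queries lie
  -- inside components, so none notices. The reserved `w` stays at `a` and ends a path of length 4.
  -- As the moved leaves come from `a`, the centres are exchanged.
  forest-unsolved : ∀ {K L M} → Forest K L M → length M + 5 ≤ n → ¬ Solved K
  forest-unsolved {K} {L} {M} F l = contra
    where
    room : ∀ k → k ≤ 2 → length (M ++ base) + k < n
    room k k≤2 rewrite length-++ M {base} | +-assoc (length M) 2 k =
      ≤-trans (subst (_≤ length M + 5) (+-suc (length M) (2 + k)) (+-monoʳ-≤ (length M) (s≤s (s≤s (s≤s k≤2))))) l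
    contra : ¬ Solved K
    contra with new-colour (M ++ base) (a ∷ []) (room 1 (s≤s z≤n))
    ... | v , v≁a ∷ [] with new-colour (M ++ base) (a ∷ v ∷ []) (room 2 ≤-refl)
    ... | u , u≁a ∷ u≁v ∷ [] with forest-relabel F u u≁a false
    ... | L′ , F′ , Lu , _ with forest-relabel F′ v v≁a true
    ... | L″ , F″ , Lv , away =
      Bistar.unsolved-class b a sp sp-b sp-a (λ z p q → sp-rest z q p) (λ z → not (L″ z))
        (cong not (Lb F″)) (cong not (La F″)) u (λ { refl → u≁a (sym (component-base M (here refl))) })
        (cong not (trans (away u u≁v) Lu))
        (component M) v w (cong not Lv) v≁a w≢a (cong not (Lw F″))
        (λ e → v≁a (trans (sym e) (sym (component-base M (there (here refl))))))
        (answered-not L″ (answered F″))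
        (All.map (λ { {x , y , d} e → (λ _ → e) , (λ { refl _ f → u≁v (trans e f) }) ,
                                      (λ { refl _ f → u≁v (trans (sym e) f) }) }) (joined F″))

  -- The final phase, with all labels fixed

  module Fixed (L : Fin n → Bool) (w₁ w₂ : Fin n) (Lw₁ : L w₁ ≡ true) (Lw₂ : L w₂ ≡ false) where

    -- Hanging a vertex from `w₁` would change its queried distance to `w₁`. Such a vertex must stay
    -- at `b`, which is expressed by giving it the colour of `b`; likewise for `w₂` and `a`.
    Forced : Edges n → Fin n → Fin n → Set
    Forced E x y = (x ≡ w₁ → L y ≡ false → colour E y ≡ colour E b)
                 × (x ≡ w₂ → L y ≡ true → colour E y ≡ colour E a)

    Respected : Edges n → Fin n → Fin n → Set
    Respected E x y = (L x ≡ L y → colour E x ≡ colour E y) × Forced E x y × Forced E y x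

    respected-mono : ∀ E e {x y} → Respected E x y → Respected (e ∷ E) x y
    respected-mono E e (p , (q , r) , (s , t)) =
      (λ i → colour-mono E e (p i)) ,
      ((λ i j → colour-mono E e (q i j)) , (λ i j → colour-mono E e (r i j))) ,
      ((λ i j → colour-mono E e (s i j)) , (λ i j → colour-mono E e (t i j)))

    -- The single edge charged to a query. The pair {w₁, w₂} imposes two constraints; the one on w₂
    -- is prepaid by w₂∼b in Final.
    connector : Fin n → Fin n → Fin n × Fin n
    connector x y with L x ≟ᵇ L y | x ≟ w₂ | y ≟ w₂ | x ≟ w₁ | y ≟ w₁
    ... | yes _ | _     | _     | _     | _     = x , y
    ... | no _  | yes _ | _     | _     | _     = a , y
    ... | no _  | no _  | yes _ | _     | _     = a , x
    ... | no _  | no _  | no _  | yes _ | _     = b , y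
    ... | no _  | no _  | no _  | no _  | yes _ = b , x
    ... | no _  | no _  | no _  | no _  | no _  = x , y

    connector-respected : ∀ {E} → colour E w₂ ≡ colour E b → ∀ x y →
                          colour E (proj₁ (connector x y)) ≡ colour E (proj₂ (connector x y)) → Respected E x y
    connector-respected {E} w₂∼b x y h with L x ≟ᵇ L y | x ≟ w₂ | y ≟ w₂ | x ≟ w₁ | y ≟ w₁
    ... | yes e | _ | _ | _ | _ =
      (λ _ → h) ,
      ((λ { refl q → ⊥-elim (true≢false (trans (sym e) Lw₁) q) }) , (λ { refl q → ⊥-elim (true≢false q (trans (sym e) Lw₂)) })) ,
      ((λ { refl q → ⊥-elim (true≢false (trans e Lw₁) q) }) , (λ { refl q → ⊥-elim (true≢false q (trans e Lw₂)) }))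
    ... | no d | yes refl | _ | _ | _ =
      (λ e → ⊥-elim (d e)) ,
      ((λ { refl _ → ⊥-elim (true≢false Lw₁ Lw₂) }) , (λ _ _ → sym h)) ,
      ((λ _ _ → w₂∼b) , (λ { refl → ⊥-elim (d refl) }))
    ... | no d | no _ | yes refl | _ | _ =
      (λ e → ⊥-elim (d e)) ,
      ((λ _ _ → w₂∼b) , (λ { refl → ⊥-elim (d refl) })) ,
      ((λ { refl _ → ⊥-elim (true≢false Lw₁ Lw₂) }) , (λ _ _ → sym h))
    ... | no d | no p | no q | yes refl | _ =
      (λ e → ⊥-elim (d e)) ,
      ((λ _ _ → sym h) , (λ e → ⊥-elim (p e))) ,
      ((λ { refl → ⊥-elim (d refl) }) , (λ e → ⊥-elim (q e)))
    ... | no d | no p | no q | no r | yes refl =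
      (λ e → ⊥-elim (d e)) ,
      ((λ e → ⊥-elim (r e)) , (λ e → ⊥-elim (p e))) ,
      ((λ _ _ → sym h) , (λ e → ⊥-elim (q e)))
    ... | no d | no p | no q | no r | no s =
      (λ e → ⊥-elim (d e)) ,
      ((λ e → ⊥-elim (r e)) , (λ e → ⊥-elim (p e))) ,
      ((λ e → ⊥-elim (s e)) , (λ e → ⊥-elim (q e)))

  open Fixed using (Respected; connector; connector-respected; respected-mono)

  -- Equal colours in `E` mean that vertices with equal labels must move together. The leaves `z₁`
  -- and `z₂`, bound to `b` and `a`, are the far ends of the paths of length 4.
  record Final (K : Knowledge n) : Set where
    field
      L           : Fin n → Bool
      w₁ w₂ z₁ z₂ : Fin n
      E           : Edges n
      L-a         : L a ≡ true
      L-b         : L b ≡ false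
      Lw₁         : L w₁ ≡ true
      Lw₂         : L w₂ ≡ false
      Lz₁         : L z₁ ≡ false
      Lz₂         : L z₂ ≡ true
      w₁≢a        : w₁ ≢ a
      w₂≢b        : w₂ ≢ b
      z₁≢b        : z₁ ≢ b
      z₂≢a        : z₂ ≢ a
      z₁∼b        : colour E z₁ ≡ colour E b
      z₂∼a        : colour E z₂ ≡ colour E a
      w₂∼b        : colour E w₂ ≡ colour E b
      answers     : All (Answered L) K
      respected   : All (λ (x , y , d) → Respected L w₁ w₂ Lw₁ Lw₂ E x y) K
      -- Here 7 is 4 + 3: the `n - 4` joining queries add nothing to `E`, and three edges of `E`
      -- belong to no query.
      budget      : length E + n ≤ length K + 7

  final-step : ∀ {K} → Final K → ∀ {x y} → x ≢ y → ∃ λ d → Final ((x , y , d) ∷ K)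
  final-step {K} F {x} {y} x≢y = answer sp L x y , record
    { L = L ; w₁ = w₁ ; w₂ = w₂ ; z₁ = z₁ ; z₂ = z₂ ; E = e ∷ E
    ; L-a = L-a ; L-b = L-b ; Lw₁ = Lw₁ ; Lw₂ = Lw₂ ; Lz₁ = Lz₁ ; Lz₂ = Lz₂
    ; w₁≢a = w₁≢a ; w₂≢b = w₂≢b ; z₁≢b = z₁≢b ; z₂≢a = z₂≢a
    ; z₁∼b = colour-mono E e z₁∼b ; z₂∼a = colour-mono E e z₂∼a ; w₂∼b = colour-mono E e w₂∼b
    ; answers   = (x≢y , refl) ∷ answers
    ; respected = connector-respected L w₁ w₂ Lw₁ Lw₂ {e ∷ E} (colour-mono E e w₂∼b) x y (colour-here E (proj₁ e) (proj₂ e))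
                  ∷ All.map (λ { {u , v , _} r → respected-mono L w₁ w₂ Lw₁ Lw₂ E e {u} {v} r }) respected
    ; budget    = s≤s budget
    }
    where
    open Final F
    e = connector L w₁ w₂ Lw₁ Lw₂ x y

  -- Below the bound `E` has fewer than `n - 2` edges, so some `v` has a colour different from those
  -- of `a` and `b`. The vertices of this colour labelled like `v` can move from `b` to `w₁` or from
  -- `a` to `w₂`.
  final-solved : ∀ {K} → Final K → Solved K → 2 * n ∸ 9 ≤ length K
  final-solved {K} F sol with 2 * n ∸ 9 ≤? length K
  ... | yes l = l
  ... | no ¬l = ⊥-elim (contra sol)
    where
    open Final F
    room : length E + 2 < n
    room = +-cancelʳ-≤ n _ _ (begin
      suc (length E + 2) + n     ≡⟨ solve 2 (λ e m → con 1 :+ (e :+ con 2) :+ m := (e :+ m) :+ con 3) refl (length E) n ⟩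
      length E + n + 3           ≤⟨ +-monoˡ-≤ 3 budget ⟩
      length K + 7 + 3           ≡⟨ solve 1 (λ k → k :+ con 7 :+ con 3 := con 1 :+ k :+ con 9) refl (length K) ⟩
      suc (length K) + 9         ≤⟨ +-monoˡ-≤ 9 (≰⇒> ¬l) ⟩
      -- The truncated subtraction is exact because `5 ≤ n`.
      2 * n ∸ 9 + 9              ≡⟨ m∸n+n≡m (≤-trans (n≤1+n 9) (*-monoʳ-≤ 2 5≤n)) ⟩
      2 * n                      ≡⟨ cong (n +_) (+-identityʳ n) ⟩
      n + n                      ∎)
      where open ≤-Reasoning
    contra : ¬ Solved K
    contra with new-colour E (a ∷ b ∷ []) room
    ... | v , v≁a ∷ v≁b ∷ [] with true⊎false (L v)
    ... | inj₂ Lv =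
      Bistar.unsolved-class a b sp sp-a sp-b sp-rest L L-a L-b w₁ w₁≢a Lw₁
        (colour E) v z₁ Lv v≁b z₁≢b Lz₁ (λ e → v≁b (trans (sym e) z₁∼b)) answers
        (All.map (λ { {x , y , d} (p , (q , _) , (r , _)) → p , (λ i j k → v≁b (trans (sym k) (q i j))) ,
                                                            (λ i j k → v≁b (trans (sym k) (r i j))) }) respected)
    ... | inj₁ Lv =
      Bistar.unsolved-class b a sp sp-b sp-a (λ z p q → sp-rest z q p) (λ z → not (L z))
        (cong not L-b) (cong not L-a) w₂ w₂≢b (cong not Lw₂)
        (colour E) v z₂ (cong not Lv) v≁a z₂≢a (cong not Lz₂) (λ e → v≁a (trans (sym e) z₂∼a)) (answered-not L answers)
        (All.map (λ { {x , y , d} (p , (_ , q) , (_ , r)) → (λ e → p (not-injective e)) ,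
                      (λ i j k → v≁a (trans (sym k) (q i (not-false j)))) ,
                      (λ i j k → v≁a (trans (sym k) (r i (not-false j)))) }) respected)

  -- Passage to the final phase

  -- With z as its only possible neighbour, t imposes no constraint beyond z staying with q.
  pick-neighbour : ∀ {L M t} q β → AtMostOneNbr M t → ∀ f → f ≢ q → L f ≡ β →
                   ∃ λ z → z ≢ q × L z ≡ β × (∀ u → Nbr M t u → L u ≡ β → u ≡ q ⊎ u ≡ z)
  pick-neighbour {L} q β (z , h) f f≢q Lf with z ≟ q | L z ≟ᵇ β
  ... | no p     | yes e = z , p , e , λ u m _ → inj₂ (h u m)
  ... | yes refl | _     = f , f≢q , Lf , λ u m _ → inj₁ (h u m)
  ... | no _     | no d  = f , f≢q , Lf , λ u m e → ⊥-elim (d (trans (cong L (sym (h u m))) e))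

  -- Queries in `M` have unequal labels, hence constrain only neighbours of `w₁` and `w₂`, at most
  -- one for each. The vertices `w₂` and `w₁` serve as fallbacks for `z₁` and `z₂`.
  finalise-with : ∀ {K L M} → Forest K L M → length M + 4 ≡ n → ∀ {w₁ w₂} →
                  Regular w₁ → Regular w₂ → AtMostOneNbr M w₁ → AtMostOneNbr M w₂ →
                  L w₁ ≡ true → L w₂ ≡ false → Final K
  finalise-with {K} {L} {M} F l {w₁} {w₂} (w₁≢a , _) (_ , w₂≢b) one₁ one₂ Lw₁ Lw₂
    with pick-neighbour {L} {M} b false one₁ w₂ w₂≢b Lw₂ | pick-neighbour {L} {M} a true one₂ w₁ w₁≢a Lw₁
  ... | z₁ , z₁≢b , Lz₁ , nbr₁ | z₂ , z₂≢a , Lz₂ , nbr₂ = record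
    { L = L ; w₁ = w₁ ; w₂ = w₂ ; z₁ = z₁ ; z₂ = z₂ ; E = E
    ; L-a = La F ; L-b = Lb F ; Lw₁ = Lw₁ ; Lw₂ = Lw₂ ; Lz₁ = Lz₁ ; Lz₂ = Lz₂
    ; w₁≢a = w₁≢a ; w₂≢b = w₂≢b ; z₁≢b = z₁≢b ; z₂≢a = z₂≢a
    ; z₁∼b = z₁∼b ; z₂∼a = z₂∼a ; w₂∼b = w₂∼b
    ; answers   = answered F
    ; respected = All.map (λ { {x , y , d} (inj₁ m) → merge m ; {x , y , d} (inj₂ m) → non-merge m }) (covered F)
    ; budget    = begin
        3 + length (map conn (N F)) + n            ≡⟨ cong₂ (λ i j → 3 + i + j) (length-map conn (N F)) (sym l) ⟩
        3 + length (N F) + (length M + 4)          ≡⟨ solve 2 (λ i j → con 3 :+ i :+ (j :+ con 4) := j :+ i :+ con 7) refl (length (N F)) (length M) ⟩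
        length M + length (N F) + 7                ≤⟨ +-monoˡ-≤ 7 (count F) ⟩
        length K + 7                               ∎
    }
    where
    open ≤-Reasoning
    conn : Fin n × Fin n → Fin n × Fin n
    conn (x , y) = connector L w₁ w₂ Lw₁ Lw₂ x y
    E : Edges n
    -- The first two edges settle all of `M`, the third is the prepaid constraint for the pair of
    -- `w₁` and `w₂`, and each query in `N F` pays for one more.
    E = (b , z₁) ∷ (a , z₂) ∷ (b , w₂) ∷ map conn (N F)
    z₁∼b : colour E z₁ ≡ colour E b
    z₁∼b = sym (colour-edge E (here refl))
    z₂∼a : colour E z₂ ≡ colour E a
    z₂∼a = sym (colour-edge E (there (here refl)))
    w₂∼b : colour E w₂ ≡ colour E b
    w₂∼b = sym (colour-edge E (there (there (here refl))))
    non-merge : ∀ {x y} → (x , y) ∈ N F → Respected L w₁ w₂ Lw₁ Lw₂ E x y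
    non-merge {x} {y} m = connector-respected L w₁ w₂ Lw₁ Lw₂ {E} w₂∼b x y
                            (colour-edge E (there (there (there (∈-map⁺ conn m)))))
    forced : ∀ {x y} → Nbr M x y → Fixed.Forced L w₁ w₂ Lw₁ Lw₂ E x y
    forced {x} {y} m =
      (λ { refl e → [ cong (colour E) , (λ q → trans (cong (colour E) q) z₁∼b) ]′ (nbr₁ y m e) }) ,
      (λ { refl e → [ cong (colour E) , (λ q → trans (cong (colour E) q) z₂∼a) ]′ (nbr₂ y m e) })
    merge : ∀ {x y} → (x , y) ∈ M → Respected L w₁ w₂ Lw₁ Lw₂ E x y
    merge m = (λ e → ⊥-elim (xor-true (M-differ F m) e)) , forced (inj₁ m) , forced (inj₂ m)

  -- The component of `a` has a tip other than `a`, and in a second component no tip can be `a`, so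
  -- both tips are regular. Flipping the second component makes their labels differ, and the labels
  -- decide which is `w₁`.
  finalise : ∀ {K L M} → Forest K L M → length M + 4 ≡ n → Final K
  finalise {K} {L} {M} F l with new-colour (M ++ base) (a ∷ []) room
    where
    room : length (M ++ base) + 1 < n
    room rewrite length-++ M {base} | +-assoc (length M) 2 1 =
      ≤-reflexive (trans (sym (+-suc (length M) 3)) l)
  ... | v , v≁a ∷ [] with tips F a a | tips F v a
  ... | t , _ , inj₁ refl , inj₁ d | _ = ⊥-elim (d refl)
  ... | t , _ , inj₁ refl , inj₂ ((d , _) , _) | _ = ⊥-elim (d refl)
  ... | _ | s , e , inj₁ refl , _ = ⊥-elim (v≁a (sym e))
  ... | t , t∼a , inj₂ (rt , one-t) , _ | s , s∼v , inj₂ (rs , one-s) , _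
    with forest-relabel F s (λ e → v≁a (trans (sym s∼v) e)) (not (L t))
  ... | L′ , F′ , Ls , away with true⊎false (L t)
  ... | inj₁ Lt = finalise-with F′ l rt rs one-t one-s
          (trans (away t (λ e → v≁a (trans (sym s∼v) (trans (sym e) t∼a)))) Lt) (trans Ls (cong not Lt))
  ... | inj₂ Lt = finalise-with F′ l rs rt one-s one-t (trans Ls (cong not Lt))
          (trans (away t (λ e → v≁a (trans (sym s∼v) (trans (sym e) t∼a)))) Lt)

  -- The game against an algorithm

  data State (K : Knowledge n) : Set where
    growing : ∀ {L M} → Forest K L M → length M + 5 ≤ n → State K
    fixed   : Final K → State K

  initial : State []
  initial = growing {L = λ v → not (does (v ≟ b))} record
    { N = [] ; La = cong not (dec-false (a ≟ b) a≢b) ; Lb = cong not (dec-true (b ≟ b) refl)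
    ; Lw = cong not (dec-false (w ≟ b) w≢b) ; M-differ = λ () ; answered = [] ; joined = [] ; covered = []
    ; tips = tips-[] ; count = z≤n } 5≤n

  state-step : ∀ {K} → State K → ∀ {x y} → x ≢ y → ∃ λ d → State ((x , y , d) ∷ K)
  state-step (fixed F) x≢y = let d , F′ = final-step F x≢y in d , fixed F′
  state-step (growing {L} {M} F l) {x} {y} x≢y with component M x ≟ component M y
  ... | yes x∼y = _ , growing (forest-join F x≢y x∼y) l
  ... | no x≁y with forest-separate F x≢y x≁y | m≤n⇒m<n∨m≡n l
  ... | L′ , F′ | inj₁ l′ = _ , growing F′ l′
  -- This query is the joining query number `n - 4` and leaves two components.
  ... | L′ , F′ | inj₂ l′ = _ , fixed (finalise F′ (trans (sym (+-suc (length M) 4)) l′))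

  state-solved : ∀ {K} → State K → Solved K → 2 * n ∸ 9 ≤ length K
  state-solved (growing F l) sol = ⊥-elim (forest-unsolved F l sol)
  state-solved (fixed F)     sol = final-solved F sol

  -- `Good` speaks of actual hidden trees, so the adversary needs one that realises its answers: the
  -- unshifted double star.
  state-tree : ∀ {K} → State K → ∃ λ T → IsTree T × Consistent T K
  state-tree (growing {L} F _) = B.Star.graph , B.Star.isTree , B.star-consistent (answered F)
    where module B = Bistar a b sp sp-a sp-b sp-rest L (La F) (Lb F) w w≢a (Lw F)
  state-tree (fixed F) = B.Star.graph , B.Star.isTree , B.star-consistent answers
    where
    open Final F
    module B = Bistar a b sp sp-a sp-b sp-rest L L-a L-b w₁ w₁≢a Lw₁

  -- The hypothesis covers all consistent trees at once. One of them reveals whether the state is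
  -- solved or a query follows; the adversary's answer then restricts the family.
  lower-bound : ∀ {K} → State K → ∀ A k → (∀ T → IsTree T → Consistent T K → Good T K A k) →
                2 * n ∸ 9 ≤ length K + k
  lower-bound {K} s A k good with 2 * n ∸ 9 ≤? length K + k
  ... | yes l = l
  ... | no ¬l with state-tree s
  ... | T , tree , ok with good T tree ok
  ... | done sol = ≤-trans (state-solved s sol) (m≤m+n _ k)
  lower-bound {K} s (ask x y x≢y f) (suc k) good | no ¬l | T , tree , ok | step _ _
    with state-step s x≢y
  ... | d , s′ = subst (2 * n ∸ 9 ≤_) (sym (+-suc (length K) k)) (lower-bound s′ (f d) k next)
    where
    next : ∀ T → IsTree T → Consistent T ((x , y , d) ∷ K) → Good T ((x , y , d) ∷ K) (f d) k
    next T tree (xy ∷ ok) with good T tree ok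
    -- Being solved does not depend on the tree, so another tree cannot end the run earlier.
    ... | done sol = ⊥-elim (¬l (≤-trans (state-solved s sol) (m≤m+n _ (suc k))))
    ... | step xy′ g with dist-unique xy′ xy
    ... | refl = g

theorem1p1 : ∀ (n : ℕ) → 1 ≤ n → ∀ (k : ℕ) (A : Alg n) →
    (∀ (T : Graph n) → IsTree T → Good T [] A k) → 2 * n ∸ 9 ≤ k
-- For `n` up to 4 the truncated difference is 0.
theorem1p1 0 _ _ _ _ = z≤n
theorem1p1 1 _ _ _ _ = z≤n
theorem1p1 2 _ _ _ _ = z≤n
theorem1p1 3 _ _ _ _ = z≤n
theorem1p1 4 _ _ _ _ = z≤n
theorem1p1 (suc (suc (suc (suc (suc m))))) _ k A good = lower-bound initial A k (λ T tree _ → good T tree)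
  where open Adversary {5 + m} zero (suc zero) (suc (suc zero)) (λ ()) (λ ()) (λ ())
               (s≤s (s≤s (s≤s (s≤s (s≤s z≤n)))))
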